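{- Let $F$ be an isonemal periodic fabric of order greater than $4$ whose symmetry group contains a quarter-turn symmetry (side-preserving or side-reversing), and suppose the strands of $F$ are coloured by thin striping so that the colouring is perfect. Then the pattern of the coloured fabric, regarded as a design, is not the design of an isonemal prefabric that falls apart.
   Context: A prefabric consists of two layers of parallel strands of unit width in a plane $E$: warps (vertical) and wefts (horizontal); each warp crosses each weft in a unit square cell, in which one of the two strands is specified uppermost. Prefabrics are periodic (invariant under two independent translations). A prefabric falls apart if some nonempty proper subset $S$ of its strands is uppermost at every crossing of a strand of $S$ with a strand not in $S$; a fabric is a prefabric that does not fall apart. The design of a prefabric is the array of cells, viewed from the obverse side, with a cell dark if the warp is uppermost and pale if the weft is uppermost; any dark/pale array of cells is the design of a unique prefabric. A symmetry is an isometry $\sigma$ of the plane preserving the cell grid, either side-preserving or side-reversing (combined with reflection $\tau$ in $E$ exchanging the sides), such that for every cell $c$ the design colour of $\sigma(c)$ equals that of $c$, complemented once if $\sigma$ interchanges vertical and horizontal directions and once more if $\sigma$ is side-reversing. The symmetries form the symmetry group $G_1$; the prefabric is isonemal if $G_1$ is transitive on the set of all strands. The order of an isonemal prefabric is the period of the over/under sequence along any strand. Thin striping colours warps alternately dark and pale and wefts alternately dark and pale; the pattern shows in each cell the colour of the uppermost strand. The colouring is perfect if every symmetry in $G_1$ either preserves the colours of all strands or interchanges dark and pale strands. -}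

module Defs where

open import Data.Bool using (Bool; true; false; not; if_then_else_; _xor_)
open import Data.Integer using (ℤ; +_; _+_; -_; 1ℤ)
open import Data.Nat using (ℕ; suc) renaming (_<_ to _<ℕ_)
open import Data.Product using (Σ; _×_; _,_)
open import Data.Sum using (_⊎_)
open import Data.Unit using (⊤)
open import Relation.Binary.PropositionalEquality using (_≡_)
open import Relation.Nullary using (¬_)

-- Cells of the grid are indexed by ℤ × ℤ: cell (i , j) is the crossing
-- of warp i (vertical, column i) with weft j (horizontal, row j).
Cell : Set
Cell = ℤ × ℤ

-- A design: true = dark (warp uppermost), false = pale (weft uppermost),
-- viewed from the obverse side.  A design determines a unique prefabric.
Design : Set
Design = Cell → Bool

-- Periodic: invariant under two independent translations.  Any rank-2
-- sublattice of ℤ² contains (Nℤ)² for some N > 0, so this is equivalent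
-- to invariance under translations by (N,0) and (0,N).
Periodic : Design → Set
Periodic D = Σ ℕ λ n →
  ((x y : ℤ) → D (x + + suc n , y) ≡ D (x , y)) ×
  ((x y : ℤ) → D (x , y + + suc n) ≡ D (x , y))

data Strand : Set where
  warp : ℤ → Strand
  weft : ℤ → Strand

-- Over D s t : strand s is uppermost at its crossing with t
-- (vacuous when s and t are parallel, as they do not cross).
Over : Design → Strand → Strand → Set
Over D (warp i) (weft j) = D (i , j) ≡ true
Over D (weft j) (warp i) = D (i , j) ≡ false
Over D (warp _) (warp _) = ⊤
Over D (weft _) (weft _) = ⊤

FallsApart : Design → Set₁
FallsApart D = Σ (Strand → Set) λ S →
  Σ Strand S × Σ Strand (λ t → ¬ S t) ×
  ((s t : Strand) → S s → ¬ S t → Over D s t)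

Prefabric : Design → Set
Prefabric = Periodic

Fabric : Design → Set₁
Fabric D = Periodic D × ¬ FallsApart D

-- Isometries preserving the cell grid, acting on cell indices as
-- c ↦ A c + b, A one of the 8 signed permutation matrices:
-- swap = false : (x , y) ↦ (ε₁ x + b₁ , ε₂ y + b₂)
-- swap = true  : (x , y) ↦ (ε₁ y + b₁ , ε₂ x + b₂)
-- where εₖ = -1 iff negₖ = true.  rev = true : side-reversing (composed with τ).
record Sym : Set where
  constructor sym
  field
    swap neg₁ neg₂ : Bool
    b₁ b₂ : ℤ
    rev : Bool

sgn : Bool → ℤ → ℤ
sgn true  x = - x
sgn false x = x

actCell : Sym → Cell → Cell
actCell (sym false n₁ n₂ b₁ b₂ _) (x , y) = (sgn n₁ x + b₁ , sgn n₂ y + b₂)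
actCell (sym true  n₁ n₂ b₁ b₂ _) (x , y) = (sgn n₁ y + b₁ , sgn n₂ x + b₂)

actStrand : Sym → Strand → Strand
actStrand (sym false n₁ n₂ b₁ b₂ _) (warp i) = warp (sgn n₁ i + b₁)
actStrand (sym false n₁ n₂ b₁ b₂ _) (weft j) = weft (sgn n₂ j + b₂)
actStrand (sym true  n₁ n₂ b₁ b₂ _) (warp i) = weft (sgn n₂ i + b₂)
actStrand (sym true  n₁ n₂ b₁ b₂ _) (weft j) = warp (sgn n₁ j + b₁)

IsSymmetry : Design → Sym → Set
IsSymmetry D σ = (c : Cell) → D (actCell σ c) ≡ (D c xor Sym.swap σ) xor Sym.rev σ

Isonemal : Design → Set
Isonemal D = (s t : Strand) → Σ Sym λ σ → IsSymmetry D σ × actStrand σ s ≡ t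

-- quarter turn: linear part is a rotation by ±90° (swap with determinant +1)
QuarterTurn : Sym → Set
QuarterTurn σ = (Sym.swap σ ≡ true) × (Sym.neg₁ σ ≡ not (Sym.neg₂ σ))

-- over/under sequence along a strand (true = this strand is over)
seqAlong : Design → Strand → ℤ → Bool
seqAlong D (warp i) j = D (i , j)
seqAlong D (weft j) i = not (D (i , j))

IsPeriodOf : (ℤ → Bool) → ℕ → Set
IsPeriodOf f p = (k : ℤ) → f (k + + p) ≡ f k

IsMinimalPeriod : (ℤ → Bool) → ℕ → Set
IsMinimalPeriod f n =
  (0 <ℕ n) × IsPeriodOf f n × ((m : ℕ) → 0 <ℕ m → m <ℕ n → ¬ IsPeriodOf f m)

HasOrder : Design → ℕ → Set
HasOrder D n = (s : Strand) → IsMinimalPeriod (seqAlong D s) n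

-- strand colouring: true = dark, false = pale
Colouring : Set
Colouring = Strand → Bool

ThinStriping : Colouring → Set
ThinStriping c =
  ((i : ℤ) → c (warp (i + 1ℤ)) ≡ not (c (warp i))) ×
  ((j : ℤ) → c (weft (j + 1ℤ)) ≡ not (c (weft j)))

Perfect : Design → Colouring → Set
Perfect D c = (σ : Sym) → IsSymmetry D σ →
  ((s : Strand) → c (actStrand σ s) ≡ c s) ⊎
  ((s : Strand) → c (actStrand σ s) ≡ not (c s))

pattern' : Design → Colouring → Design
pattern' D c (i , j) = if D (i , j) then c (warp i) else c (weft j)

{-# OPTIONS --safe #-}

-- The pattern always falls apart (dark warps and pale wefts lie over the rest),
-- so the theorem says that it is not isonemal.
-- Perfection forces a quarter turn to be side-reversing about a cell, which we
-- take as origin.  A symmetry moving the warp through the origin to the next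
-- one interchanges the colours; up to a half turn it is either a glide
-- reflection, and then the order divides 2, or a translation (1 , t) with t
-- odd.  In the second case cell (x , y) has the colour a (y − x t) = a (x + y t)
-- for a sequence a of period t² + 1, which is twice an odd number.  A symmetry
-- of the pattern carrying a dark warp to a pale weft complements a on a class
-- modulo 2, where the period is odd; this is impossible.
module Submission where

open import Defs
open import Data.Bool using (Bool; true; false; not; if_then_else_; _xor_)
open import Data.Bool.Properties using (not-¬; not-involutive; xor-identityʳ; xor-annihilates-not)
open import Data.Empty using (⊥-elim)
open import Data.Integer using (ℤ; +_; -[1+_]; _+_; _*_; _-_; -_; 0ℤ; 1ℤ)
open import Data.Integer.Properties using (+-identityˡ; +-assoc; neg-involutive)
open import Data.Integer.Tactic.RingSolver using (solve; solve-∀)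
open import Data.List using ([]; _∷_)
open import Data.Nat using (ℕ; zero; suc; z≤n; s≤s) renaming (_<_ to _<ℕ_)
import Data.Nat.Properties as ℕ
open import Data.Product using (Σ; ∃; _×_; _,_; proj₁; proj₂)
open import Data.Sum using (_⊎_; inj₁; inj₂)
open import Relation.Binary.PropositionalEquality
  using (_≡_; refl; trans; cong; cong₂; subst) renaming (sym to ≡-sym)
open import Relation.Nullary using (¬_)

-- Parity, alternation and odd periods on the integers.

step-invariant⇒constant : ∀ {a} {A : Set a} (f : ℤ → A) →
  (∀ k → f (k + 1ℤ) ≡ f k) → ∀ k → f k ≡ f 0ℤ
step-invariant⇒constant f step (+ zero)  = refl
step-invariant⇒constant f step (+ suc n) =
  trans (cong (λ m → f (+ m)) (≡-sym (ℕ.+-comm n 1)))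
        (trans (step (+ n)) (step-invariant⇒constant f step (+ n)))
step-invariant⇒constant f step -[1+ zero ]  = ≡-sym (step -[1+ 0 ])
step-invariant⇒constant f step -[1+ suc n ] =
  trans (≡-sym (step -[1+ suc n ])) (step-invariant⇒constant f step -[1+ n ])

EvenOrOdd : ℤ → Set
EvenOrOdd x = ∃ λ k → (x ≡ k + k) ⊎ (x ≡ (k + k) + 1ℤ)

evenOrOdd-suc : ∀ x → EvenOrOdd x → EvenOrOdd (x + 1ℤ)
evenOrOdd-suc x (k , inj₁ e) = k , inj₂ (cong (_+ 1ℤ) e)
evenOrOdd-suc x (k , inj₂ e) = k + 1ℤ , inj₁ (trans (cong (_+ 1ℤ) e) (solve (k ∷ [])))

evenOrOdd-neg : ∀ x → EvenOrOdd x → EvenOrOdd (- x)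
evenOrOdd-neg x (k , inj₁ e) = - k , inj₁ (trans (cong -_ e) (solve (k ∷ [])))
evenOrOdd-neg x (k , inj₂ e) = - k - 1ℤ , inj₂ (trans (cong -_ e) (solve (k ∷ [])))

evenOrOdd-+ : ∀ n → EvenOrOdd (+ n)
evenOrOdd-+ zero    = 0ℤ , inj₁ refl
evenOrOdd-+ (suc n) =
  subst (λ m → EvenOrOdd (+ m)) (ℕ.+-comm n 1) (evenOrOdd-suc (+ n) (evenOrOdd-+ n))

evenOrOdd : ∀ x → EvenOrOdd x
evenOrOdd (+ n)    = evenOrOdd-+ n
evenOrOdd -[1+ n ] = evenOrOdd-neg (+ suc n) (evenOrOdd-+ (suc n))

y≡x+[y-x] : ∀ x y → y ≡ x + (y - x)
y≡x+[y-x] = solve-∀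

evenOrOdd-difference : ∀ x y → ∃ λ k → (y ≡ x + (k + k)) ⊎ (y ≡ (x + (k + k)) + 1ℤ)
evenOrOdd-difference x y with evenOrOdd (y - x)
... | k , inj₁ e = k , inj₁ (trans (y≡x+[y-x] x y) (cong (λ d → x + d) e))
... | k , inj₂ e = k , inj₂ (trans (y≡x+[y-x] x y)
                       (trans (cong (λ d → x + d) e) (≡-sym (+-assoc x (k + k) 1ℤ))))

Alternating : (ℤ → Bool) → Set
Alternating f = ∀ i → f (i + 1ℤ) ≡ not (f i)

module _ {f : ℤ → Bool} (alt : Alternating f) where

  alternating-even : ∀ x k → f (x + (k + k)) ≡ f x
  alternating-even x k =
    trans (step-invariant⇒constant (λ i → f (x + (i + i))) step k)
          (cong f (x+0 x))
    where
    two-steps : ∀ x i → x + ((i + 1ℤ) + (i + 1ℤ)) ≡ ((x + (i + i)) + 1ℤ) + 1ℤ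
    two-steps = solve-∀
    x+0 : ∀ x → x + (0ℤ + 0ℤ) ≡ x
    x+0 = solve-∀
    step : ∀ i → f (x + ((i + 1ℤ) + (i + 1ℤ))) ≡ f (x + (i + i))
    step i = trans (cong f (two-steps x i))
      (trans (alt _) (trans (cong not (alt _)) (not-involutive _)))

  alternating-odd : ∀ x k → f ((x + (k + k)) + 1ℤ) ≡ not (f x)
  alternating-odd x k = trans (alt _) (cong not (alternating-even x k))

  equal⇒even-difference : ∀ x y → f y ≡ f x → ∃ λ k → y ≡ x + (k + k)
  equal⇒even-difference x y eq with evenOrOdd-difference x y
  ... | k , inj₁ e    = k , e
  ... | k , inj₂ refl = ⊥-elim (not-¬ eq (alternating-odd x k))

  opposite⇒odd-difference : ∀ x y → f y ≡ not (f x) → ∃ λ k → y ≡ (x + (k + k)) + 1ℤ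
  opposite⇒odd-difference x y eq with evenOrOdd-difference x y
  ... | k , inj₁ refl = ⊥-elim (not-¬ (alternating-even x k) eq)
  ... | k , inj₂ e    = k , e

  attains : ∀ b → ∃ λ x → f x ≡ b
  attains b = by-value b (f 0ℤ) refl
    where
    by-value : ∀ b v → f 0ℤ ≡ v → ∃ λ x → f x ≡ b
    by-value true  true  e = 0ℤ , e
    by-value false false e = 0ℤ , e
    by-value true  false e = 1ℤ , trans (alt 0ℤ) (cong not e)
    by-value false true  e = 1ℤ , trans (alt 0ℤ) (cong not e)

  alternating-affine : ∀ δ b → Alternating (λ i → f (sgn δ i + b))
  alternating-affine false b i = trans (cong f (eq i b)) (alt _)
    where
    eq : ∀ i b → (i + 1ℤ) + b ≡ (i + b) + 1ℤ
    eq = solve-∀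
  alternating-affine true b i =
    ≡-sym (trans (cong not (trans (cong f (eq i b)) (alt _))) (not-involutive _))
    where
    eq : ∀ i b → - i + b ≡ (- (i + 1ℤ) + b) + 1ℤ
    eq = solve-∀

-- Both sequences flip at each step, so their exclusive or never changes.
equal-or-opposite : ∀ {f g} → Alternating f → Alternating g →
  (∀ k → f k ≡ g k) ⊎ (∀ k → f k ≡ not (g k))
equal-or-opposite {f} {g} altf altg = by-value (f 0ℤ xor g 0ℤ) refl
  where
  xor-constant : ∀ k → f k xor g k ≡ f 0ℤ xor g 0ℤ
  xor-constant = step-invariant⇒constant (λ k → f k xor g k) λ k →
    trans (cong₂ _xor_ (altf k) (altg k)) (xor-annihilates-not (f k) (g k))

  xor-false : ∀ a b → a xor b ≡ false → a ≡ b
  xor-false true  true  _ = refl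
  xor-false false false _ = refl

  xor-true : ∀ a b → a xor b ≡ true → a ≡ not b
  xor-true true  false _ = refl
  xor-true false true  _ = refl

  by-value : ∀ v → f 0ℤ xor g 0ℤ ≡ v →
    (∀ k → f k ≡ g k) ⊎ (∀ k → f k ≡ not (g k))
  by-value false e = inj₁ λ k → xor-false _ _ (trans (xor-constant k) e)
  by-value true  e = inj₂ λ k → xor-true _ _ (trans (xor-constant k) e)

-- Modulo an odd number a translation has odd order and a reflection has a fixed point.
-- Complementing an odd number of times, or complementing the value at a fixed point, is
-- contradictory.
odd-period⇒no-antisymmetry : ∀ (A : ℤ → Bool) M → (∀ l → A (l + ((M + M) + 1ℤ)) ≡ A l) →
  ∀ δ β → ¬ (∀ l → A (sgn δ l + β) ≡ not (A l))
odd-period⇒no-antisymmetry A M period false β anti =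
  not-¬ refl (trans (≡-sym m*β≡0) (alternating-odd alternates 0ℤ M))
  where
  m = (M + M) + 1ℤ

  alternates : Alternating (λ k → A (k * β))
  alternates k = trans (cong A (distrib k β)) (anti (k * β))
    where
    distrib : ∀ k β → (k + 1ℤ) * β ≡ k * β + β
    distrib = solve-∀

  constant : ∀ k → A (k * m) ≡ A (0ℤ * m)
  constant = step-invariant⇒constant (λ k → A (k * m)) λ k →
    trans (cong A (distrib k M)) (period (k * m))
    where
    distrib : ∀ k M → (k + 1ℤ) * ((M + M) + 1ℤ) ≡ k * ((M + M) + 1ℤ) + ((M + M) + 1ℤ)
    distrib = solve-∀

  m*β≡0 : A (((0ℤ + (M + M)) + 1ℤ) * β) ≡ A (0ℤ * β)
  m*β≡0 = trans (cong A (commute M β)) (constant β)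
    where
    commute : ∀ M β → ((0ℤ + (M + M)) + 1ℤ) * β ≡ β * ((M + M) + 1ℤ)
    commute = solve-∀
odd-period⇒no-antisymmetry A M period true β anti with evenOrOdd β
... | k , inj₁ refl = not-¬ refl (trans (cong A (eq k)) (anti k))
  where
  eq : ∀ k → k ≡ - k + (k + k)
  eq = solve-∀
-- The reflection exchanges `k - M` and `k + M + 1ℤ`, which differ by exactly one period.
... | k , inj₂ refl =
  not-¬ refl (trans (≡-sym (period (k - M)))
    (trans (cong A (eq₁ k M))
      (trans (≡-sym (not-involutive _))
        (cong not (trans (≡-sym (anti (k + M + 1ℤ))) (cong A (eq₂ k M)))))))
  where
  eq₁ : ∀ k M → (k - M) + ((M + M) + 1ℤ) ≡ k + M + 1ℤ
  eq₁ = solve-∀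
  eq₂ : ∀ k M → - (k + M + 1ℤ) + ((k + k) + 1ℤ) ≡ k - M
  eq₂ = solve-∀

-- Designs invariant under a quarter turn about a cell.

-- Rotations by +90° and by −90° leave the same designs invariant, so one
-- orientation suffices.
module QuarterTurnInvariant (E : ℤ → ℤ → Bool)
  (quarter : ∀ x y → E y (- x) ≡ E x y) where

  half : ∀ x y → E (- x) (- y) ≡ E x y
  half x y = trans (quarter y (- x)) (quarter x y)

  -- The glide applied twice is a translation by two along the rows, and the two factors `r` cancel;
  -- the quarter turn carries rows to columns.
  glide⇒column-period-2 : ∀ t r → (∀ x y → E (x + 1ℤ) (- y + t) ≡ E x y xor r) →
    ∀ x y → E x (y + (1ℤ + 1ℤ)) ≡ E x y
  glide⇒column-period-2 t r glide x y =
    trans (≡-sym (quarter x (y + (1ℤ + 1ℤ)))) (trans (row y (- x)) (quarter x y))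
    where
    eq₁ : ∀ x → x + (1ℤ + 1ℤ) ≡ (x + 1ℤ) + 1ℤ
    eq₁ = solve-∀
    eq₂ : ∀ y t → y ≡ - (- y + t) + t
    eq₂ = solve-∀
    xor-twice : ∀ a b → (a xor b) xor b ≡ a
    xor-twice true  true  = refl
    xor-twice true  false = refl
    xor-twice false true  = refl
    xor-twice false false = refl
    row : ∀ x y → E (x + (1ℤ + 1ℤ)) y ≡ E x y
    row x y = trans (cong₂ E (eq₁ x) (eq₂ y t))
      (trans (glide (x + 1ℤ) (- y + t))
        (trans (cong (_xor r) (glide x y)) (xor-twice (E x y) r)))

  -- The translation composed with the quarter turn fixes the cell (s + 1 , s).
  translation-side-preserving : ∀ s r →
    (∀ x y → E (x + 1ℤ) (y + ((s + s) + 1ℤ)) ≡ E x y xor r) → r ≡ false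
  translation-side-preserving s r translate =
    xor-fixed _ r (trans (cong (E (s + 1ℤ)) (eq s))
      (trans (translate s (- (s + 1ℤ))) (cong (_xor r) (quarter (s + 1ℤ) s))))
    where
    eq : ∀ s → s ≡ - (s + 1ℤ) + ((s + s) + 1ℤ)
    eq = solve-∀
    xor-fixed : ∀ a r → a ≡ a xor r → r ≡ false
    xor-fixed a     false _ = refl
    xor-fixed true  true  ()
    xor-fixed false true  ()

  module Translation (t : ℤ) (translate : ∀ x y → E (x + 1ℤ) (y + t) ≡ E x y) where

    column-reduction : ∀ x y → E x y ≡ E 0ℤ (y - x * t)
    column-reduction x y =
      trans (cong (E x) (eq₁ x y t))
        (trans (step-invariant⇒constant (λ k → E k ((y - x * t) + k * t)) step x)
               (cong (E 0ℤ) (eq₂ (y - x * t) t)))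
      where
      eq₁ : ∀ x y t → y ≡ (y - x * t) + x * t
      eq₁ = solve-∀
      eq₂ : ∀ z t → z + 0ℤ * t ≡ z
      eq₂ = solve-∀
      eq₃ : ∀ z k t → z + (k + 1ℤ) * t ≡ (z + k * t) + t
      eq₃ = solve-∀
      step : ∀ k → E (k + 1ℤ) ((y - x * t) + (k + 1ℤ) * t) ≡ E k ((y - x * t) + k * t)
      step k = trans (cong (E (k + 1ℤ)) (eq₃ (y - x * t) k t)) (translate k _)

    -- Turning a row into a column reverses the index, and the half turn removes the sign. Rows and
    -- columns are thus read from the same sequence `E 0ℤ`.
    row-reduction : ∀ x y → E x y ≡ E 0ℤ (x + y * t)
    row-reduction x y =
      trans (≡-sym (quarter x y))
        (trans (column-reduction y (- x))
          (trans (cong (E 0ℤ) (eq x y t)) (half 0ℤ (x + y * t))))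
      where
      eq : ∀ x y t → - x - y * t ≡ - (x + y * t)
      eq = solve-∀

    -- The quarter turn conjugates the translation by `(1 , t)` to that by `(t , -1)`, and `t` times
    -- the first minus the second is `(0 , t * t + 1)`.
    period : ∀ k → E 0ℤ (k + (t * t + 1ℤ)) ≡ E 0ℤ k
    period k =
      trans (cong (E 0ℤ) (eq₁ k t))
        (trans (≡-sym (column-reduction (- t) (k + 1ℤ)))
          (trans (≡-sym (quarter (- t) (k + 1ℤ)))
            (trans (cong (E (k + 1ℤ)) (eq₂ t)) (trans (translate k 0ℤ) (quarter 0ℤ k)))))
      where
      eq₁ : ∀ k t → k + (t * t + 1ℤ) ≡ (k + 1ℤ) - (- t) * t
      eq₁ = solve-∀
      eq₂ : ∀ t → - (- t) ≡ 0ℤ + t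
      eq₂ = solve-∀

-- Symmetries of a thinly striped design and of its pattern.

module Striped (D : Design) (c : Colouring) (thin : ThinStriping c) where

  χ ψ : ℤ → Bool
  χ i = c (warp i)
  ψ j = c (weft j)

  χ-alternating : Alternating χ
  χ-alternating = proj₁ thin

  ψ-alternating : Alternating ψ
  ψ-alternating = proj₂ thin

  -- By perfection the square of the turn preserves strand colours, so it moves weft 0 by an even
  -- amount and the centre is a cell rather than a corner. A side-preserving turn would complement
  -- the colour of that fixed cell; hence the turn is side-reversing and its two complementations
  -- cancel.
  quarterTurn-centre : Perfect D c → ∀ σ → IsSymmetry D σ → QuarterTurn σ →
    ∃ λ p → ∃ λ q → ∀ x y → D (p + y , q - x) ≡ D (p + x , q + y)
  quarterTurn-centre perf σ@(sym .true .(not n) n b₁ b₂ r) isSym (refl , refl) =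
    centre n (equal⇒even-difference ψ-alternating 0ℤ (sgn n b₁ + b₂) (b₁-even (perf σ isSym))) isSym
    where
    0-image : ∀ n → sgn n 0ℤ + b₁ ≡ b₁
    0-image true  = +-identityˡ b₁
    0-image false = +-identityˡ b₁

    b₁-even : ((s : Strand) → c (actStrand σ s) ≡ c s) ⊎
              ((s : Strand) → c (actStrand σ s) ≡ not (c s)) →
              ψ (sgn n b₁ + b₂) ≡ ψ 0ℤ
    b₁-even (inj₁ same) = trans (same (warp b₁))
      (trans (cong χ (≡-sym (0-image (not n)))) (same (weft 0ℤ)))
    b₁-even (inj₂ swaps) = trans (swaps (warp b₁))
      (trans (cong not (trans (cong χ (≡-sym (0-image (not n)))) (swaps (weft 0ℤ))))
             (not-involutive _))

    side-reversing : ∀ a r → a ≡ (a xor true) xor r → r ≡ true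
    side-reversing a     true  _ = refl
    side-reversing true  false ()
    side-reversing false false ()

    complemented-twice : ∀ a {b r} → r ≡ true → b ≡ (a xor true) xor r → b ≡ a
    complemented-twice true  refl e = e
    complemented-twice false refl e = e

    centre : ∀ n → (∃ λ m → sgn n b₁ + b₂ ≡ 0ℤ + (m + m)) →
      IsSymmetry D (sym true (not n) n b₁ b₂ r) →
      ∃ λ p → ∃ λ q → ∀ x y → D (p + y , q - x) ≡ D (p + x , q + y)
    -- The witnesses solve the fixed-cell equations. This turn is the inverse of the one in the
    -- conclusion, hence `≡-sym`.
    centre false (m , e) isSym = b₁ - m , m , λ x y →
      ≡-sym (complemented-twice (D ((b₁ - m) + y , m - x)) r≡true (image x y))
      where
      eq₁ : ∀ x m b₁ → - (m - x) + b₁ ≡ (b₁ - m) + x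
      eq₁ = solve-∀
      eq₂ : ∀ y m b₁ b₂ → ((b₁ - m) + y) + b₂ ≡ ((b₁ + b₂) - m) + y
      eq₂ = solve-∀
      eq₃ : ∀ y m → ((0ℤ + (m + m)) - m) + y ≡ m + y
      eq₃ = solve-∀
      image : ∀ x y → D ((b₁ - m) + x , m + y) ≡ (D ((b₁ - m) + y , m - x) xor true) xor r
      image x y = trans (≡-sym (cong₂ (λ i j → D (i , j)) (eq₁ x m b₁)
        (trans (eq₂ y m b₁ b₂) (trans (cong (λ d → (d - m) + y) e) (eq₃ y m)))))
        (isSym ((b₁ - m) + y , m - x))
      r≡true : r ≡ true
      r≡true = side-reversing _ r (image 0ℤ 0ℤ)
    centre true (m , e) isSym = m + b₁ , m , λ x y →
      complemented-twice (D ((m + b₁) + x , m + y)) r≡true (image x y)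
      where
      eq₁ : ∀ y m b₁ → (m + y) + b₁ ≡ (m + b₁) + y
      eq₁ = solve-∀
      eq₂ : ∀ x m b₁ b₂ → - ((m + b₁) + x) + b₂ ≡ (- b₁ + b₂) - m - x
      eq₂ = solve-∀
      eq₃ : ∀ x m → (0ℤ + (m + m)) - m - x ≡ m - x
      eq₃ = solve-∀
      image : ∀ x y → D ((m + b₁) + y , m - x) ≡ (D ((m + b₁) + x , m + y) xor true) xor r
      image x y = trans (≡-sym (cong₂ (λ i j → D (i , j)) (eq₁ y m b₁)
        (trans (eq₂ x m b₁ b₂) (trans (cong (λ d → d - m - x) e) (eq₃ x m)))))
        (isSym ((m + b₁) + x , m + y))
      r≡true : r ≡ true
      r≡true = side-reversing _ r (image 0ℤ 0ℤ)

  -- Neighbouring warps differ in colour, so by perfection the symmetry recolours every strand; weft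
  -- `q` therefore moves by an odd amount.
  adjacent-warp-symmetry : Perfect D c → Isonemal D → ∀ p q →
    ∃ λ n₁ → ∃ λ n₂ → ∃ λ s → ∃ λ r → ∀ x y →
      D (p + (sgn n₁ x + 1ℤ) , q + (sgn n₂ y + ((s + s) + 1ℤ))) ≡ D (p + x , q + y) xor r
  adjacent-warp-symmetry perf iso p q with iso (warp p) (warp (p + 1ℤ))
  ... | sym true  n₁ n₂ b₁ b₂ r , isSym , ()
  ... | g@(sym false n₁ n₂ b₁ b₂ r) , isSym , moves with perf g isSym
  ...   | inj₁ same  =
    ⊥-elim (not-¬ (trans (cong c (≡-sym moves)) (same (warp p))) (χ-alternating p))
  ...   | inj₂ swaps with opposite⇒odd-difference ψ-alternating q (sgn n₂ q + b₂) (swaps (weft q))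
  ...     | s , q-image = n₁ , n₂ , s , r , λ x y →
    trans (≡-sym (cong₂ (λ i j → D (i , j))
             (affine n₁ p b₁ 1ℤ (warp-injective moves) x)
             (affine n₂ q b₂ ((s + s) + 1ℤ) (trans q-image (+-assoc q (s + s) 1ℤ)) y)))
      (trans (isSym (p + x , q + y)) (cong (_xor r) (xor-identityʳ (D (p + x , q + y)))))
    where
    warp-injective : ∀ {i j} → warp i ≡ warp j → i ≡ j
    warp-injective refl = refl
    affine : ∀ n p b u → sgn n p + b ≡ p + u → ∀ x → sgn n (p + x) + b ≡ p + (sgn n x + u)
    affine true  p b u e x = trans (eq₁ p b x) (trans (cong (λ d → - x + d) e) (eq₂ p u (- x)))
      where
      eq₁ : ∀ p b x → - (p + x) + b ≡ - x + (- p + b)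
      eq₁ = solve-∀
      eq₂ : ∀ p u z → z + (p + u) ≡ p + (z + u)
      eq₂ = solve-∀
    affine false p b u e x = trans (eq₁ p b x) (trans (cong (λ d → x + d) e) (eq₂ p u x))
      where
      eq₁ : ∀ p b x → (p + x) + b ≡ x + (p + b)
      eq₁ = solve-∀
      eq₂ : ∀ p u z → z + (p + u) ≡ p + (z + u)
      eq₂ = solve-∀

  -- The pattern of a dark warp is dark at dark wefts and D elsewhere; that of a
  -- pale weft is pale at pale warps and D elsewhere.  Matching the forced cells
  -- against each other would contradict itself at the crossing (x₀ , y₀).
  dark-warp-to-pale-weft : ∀ {x₀ y₀} → χ x₀ ≡ true → ψ y₀ ≡ false → ∀ δ b r →
    (∀ j → pattern' D c (sgn δ j + b , y₀) ≡ (pattern' D c (x₀ , j) xor true) xor r) →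
    χ (sgn δ y₀ + b) ≡ true × (∀ j → ψ j ≡ false → D (sgn δ j + b , y₀) ≡ not (D (x₀ , j)))
  dark-warp-to-pale-weft {x₀} {y₀} χx₀ ψy₀ δ b r P-eq
    with equal-or-opposite (alternating-affine χ-alternating δ b) ψ-alternating
  ... | inj₁ equal = ⊥-elim
    (at-weft-y₀ _ (D (x₀ , y₀)) r (trans (equal y₀) ψy₀) ψy₀ χx₀ ψy₀
      (at-warp-x₀ _ (D (x₀ , j₀)) r χx₀ ψy₀ χx₀ ψj₀
        (subst (λ x → pattern' D c (x , y₀) ≡ (pattern' D c (x₀ , j₀) xor true) xor r)
               j₀-image (P-eq j₀)))
      (P-eq y₀))
    where
    -- The crossing of warp `x₀` with weft `j₀` is the one carried to `(x₀ , y₀)`.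
    j₀ : ℤ
    j₀ = sgn δ (x₀ - b)
    j₀-image : sgn δ j₀ + b ≡ x₀
    j₀-image = inverse δ
      where
      inverse : ∀ δ → sgn δ (sgn δ (x₀ - b)) + b ≡ x₀
      inverse true  = negated x₀ b
        where
        negated : ∀ x b → - - (x - b) + b ≡ x
        negated = solve-∀
      inverse false = plain x₀ b
        where
        plain : ∀ x b → (x - b) + b ≡ x
        plain = solve-∀
    ψj₀ : ψ j₀ ≡ true
    ψj₀ = trans (≡-sym (equal j₀)) (trans (cong χ j₀-image) χx₀)
    at-warp-x₀ : ∀ a d r {u v w z} → u ≡ true → v ≡ false → w ≡ true → z ≡ true →
      (if a then u else v) ≡ ((if d then w else z) xor true) xor r → a ≡ r
    at-warp-x₀ true  true  r refl refl refl refl e = e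
    at-warp-x₀ true  false r refl refl refl refl e = e
    at-warp-x₀ false true  r refl refl refl refl e = e
    at-warp-x₀ false false r refl refl refl refl e = e
    at-weft-y₀ : ∀ a d r {u v w z} → u ≡ false → v ≡ false → w ≡ true → z ≡ false → d ≡ r →
      ¬ ((if a then u else v) ≡ ((if d then w else z) xor true) xor r)
    at-weft-y₀ true  true  _ refl refl refl refl refl ()
    at-weft-y₀ true  false _ refl refl refl refl refl ()
    at-weft-y₀ false true  _ refl refl refl refl refl ()
    at-weft-y₀ false false _ refl refl refl refl refl ()
  -- Now forced cells go to forced cells. A dark weft shows that `r` is false, and at pale wefts
  -- both patterns show `D`.
  ... | inj₂ opposite =
    trans (opposite y₀) (cong not ψy₀) , λ j ψj →
      at-pale-weft _ _ r side (trans (opposite j) (cong not ψj)) ψy₀ χx₀ ψj (P-eq j)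
    where
    ψ-next : ψ (y₀ + 1ℤ) ≡ true
    ψ-next = trans (ψ-alternating y₀) (cong not ψy₀)
    at-dark-weft : ∀ a d r {u v w z} → u ≡ false → v ≡ false → w ≡ true → z ≡ true →
      (if a then u else v) ≡ ((if d then w else z) xor true) xor r → r ≡ false
    at-dark-weft true  true  r refl refl refl refl e = ≡-sym e
    at-dark-weft true  false r refl refl refl refl e = ≡-sym e
    at-dark-weft false true  r refl refl refl refl e = ≡-sym e
    at-dark-weft false false r refl refl refl refl e = ≡-sym e
    side : r ≡ false
    side = at-dark-weft _ (D (x₀ , y₀ + 1ℤ)) r (trans (opposite _) (cong not ψ-next)) ψy₀ χx₀ ψ-next (P-eq (y₀ + 1ℤ))
    at-pale-weft : ∀ a d r {u v w z} → r ≡ false → u ≡ true → v ≡ false → w ≡ true → z ≡ false →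
      (if a then u else v) ≡ ((if d then w else z) xor true) xor r → a ≡ not d
    at-pale-weft true  false _ refl refl refl refl refl _ = refl
    at-pale-weft false true  _ refl refl refl refl refl _ = refl
    at-pale-weft true  true  _ refl refl refl refl refl ()
    at-pale-weft false false _ refl refl refl refl refl ()

  -- The case of a translation by `(1 , t)` with `t` odd.

  module OddTranslation (p q s : ℤ)
    (quarter : ∀ x y → D (p + y , q - x) ≡ D (p + x , q + y))
    (translate : ∀ x y → D (p + (x + 1ℤ) , q + (y + ((s + s) + 1ℤ))) ≡ D (p + x , q + y)) where

    t : ℤ
    t = (s + s) + 1ℤ

    E : ℤ → ℤ → Bool
    E x y = D (p + x , q + y)

    open QuarterTurnInvariant E quarter
    open Translation t translate

    recentre : ∀ i j → D (i , j) ≡ E (i - p) (j - q)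
    recentre i j = cong₂ (λ i j → D (i , j)) (eq p i) (eq q j)
      where
      eq : ∀ p i → i ≡ p + (i - p)
      eq = solve-∀

    pattern-not-isonemal : ¬ Isonemal (pattern' D c)
    pattern-not-isonemal iso
      with x₀ , χx₀ ← attains χ-alternating true
      with y₀ , ψy₀ ← attains ψ-alternating false
      with iso (warp x₀) (weft y₀)
    ... | sym true δ n₂ b b₂ r , isSym , refl
      with χ-image , opposite ← dark-warp-to-pale-weft χx₀ ψy₀ δ b r (λ j → isSym (x₀ , j))
      with w , w-eq ← equal⇒even-difference χ-alternating x₀
             (sgn δ y₀ + b) (trans χ-image (≡-sym χx₀))
      = odd-period⇒no-antisymmetry A (s * s + s) A-period δ (w + z) A-opposite
      where
      -- The column and row reductions give the cell `(x₀ , y₀)` the indices `e` and `e + (z + z)`;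
      -- these agree in parity because `t` is odd.
      e z : ℤ
      e = (y₀ - q) - (x₀ - p) * t
      z = (x₀ - p) * (s + 1ℤ) + (y₀ - q) * s

      -- The pale wefts are the `y₀ + (l + l)`, and their crossings with warp `x₀` have the indices
      -- `e + (l + l)`. Halving the index also halves the period `t * t + 1`, which leaves an odd
      -- one.
      A : ℤ → Bool
      A l = E 0ℤ (e + (l + l))

      A-period : ∀ l → A (l + (((s * s + s) + (s * s + s)) + 1ℤ)) ≡ A l
      A-period l = trans (cong (E 0ℤ) (eq e l s)) (period (e + (l + l)))
        where
        eq : ∀ e l s → e + ((l + (((s * s + s) + (s * s + s)) + 1ℤ)) +
                            (l + (((s * s + s) + (s * s + s)) + 1ℤ)))
                     ≡ (e + (l + l)) + (((s + s) + 1ℤ) * ((s + s) + 1ℤ) + 1ℤ)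
        eq = solve-∀

      on-warp : ∀ l → D (x₀ , y₀ + (l + l)) ≡ A l
      on-warp l = trans (recentre x₀ (y₀ + (l + l)))
        (trans (column-reduction (x₀ - p) _) (cong (E 0ℤ) (eq y₀ q l ((x₀ - p) * t))))
        where
        eq : ∀ y q l v → ((y + (l + l)) - q) - v ≡ ((y - q) - v) + (l + l)
        eq = solve-∀

      on-weft : ∀ l → D (sgn δ (y₀ + (l + l)) + b , y₀) ≡ A (sgn δ l + (w + z))
      on-weft l = trans (recentre _ y₀)
        (trans (row-reduction _ (y₀ - q))
          (cong (E 0ℤ) (trans (cong (λ x → (x - p) + (y₀ - q) * t) (image δ w-eq))
                              (eq x₀ y₀ p q s w (sgn δ l)))))
        where
        image : ∀ δ → sgn δ y₀ + b ≡ x₀ + (w + w) →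
          sgn δ (y₀ + (l + l)) + b ≡ (x₀ + (w + w)) + (sgn δ l + sgn δ l)
        image true e = trans (eq₁ y₀ l b) (cong (_+ (- l + - l)) e)
          where
          eq₁ : ∀ y l b → - (y + (l + l)) + b ≡ (- y + b) + (- l + - l)
          eq₁ = solve-∀
        image false e = trans (eq₁ y₀ l b) (cong (_+ (l + l)) e)
          where
          eq₁ : ∀ y l b → (y + (l + l)) + b ≡ (y + b) + (l + l)
          eq₁ = solve-∀
        eq : ∀ x₀ y₀ p q s w l →
          (((x₀ + (w + w)) + (l + l)) - p) + (y₀ - q) * ((s + s) + 1ℤ)
          ≡ ((y₀ - q) - (x₀ - p) * ((s + s) + 1ℤ)) +
            ((l + (w + ((x₀ - p) * (s + 1ℤ) + (y₀ - q) * s))) +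
             (l + (w + ((x₀ - p) * (s + 1ℤ) + (y₀ - q) * s))))
        eq = solve-∀

      A-opposite : ∀ l → A (sgn δ l + (w + z)) ≡ not (A l)
      A-opposite l = trans (≡-sym (on-weft l))
        (trans (opposite (y₀ + (l + l)) (trans (alternating-even ψ-alternating y₀ l) ψy₀))
               (cong not (on-warp l)))

-- Elimination of both types of adjacent-warp symmetry.

theorem3p3 : (D : Design) → Fabric D → Isonemal D →
    Σ ℕ (λ n → HasOrder D n × 4 <ℕ n) →
    Σ Sym (λ σ → IsSymmetry D σ × QuarterTurn σ) →
    (c : Colouring) → ThinStriping c → Perfect D c →
    ¬ (Prefabric (pattern' D c) × Isonemal (pattern' D c) × FallsApart (pattern' D c))
theorem3p3 D _ iso (n , order , 4<n) (σ , isSym , quarterTurn) c thin perf (_ , patternIso , _)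
  with p , q , quarter ← Striped.quarterTurn-centre D c thin perf σ isSym quarterTurn
  with n₁ , n₂ , s , r , moves ← Striped.adjacent-warp-symmetry D c thin perf iso p q
  = by-linear-part n₁ n₂ moves
  where
  open Striped D c thin
  E : ℤ → ℤ → Bool
  E x y = D (p + x , q + y)
  open QuarterTurnInvariant E quarter

  t : ℤ
  t = (s + s) + 1ℤ

  translation-impossible : ¬ (∀ x y → E (x + 1ℤ) (y + t) ≡ E x y xor r)
  translation-impossible translate with translation-side-preserving s r translate
  ... | refl = OddTranslation.pattern-not-isonemal p q s quarter
                 (λ x y → trans (translate x y) (xor-identityʳ _)) patternIso

  glide-impossible : ¬ (∀ x y → E (x + 1ℤ) (- y + t) ≡ E x y xor r)
  -- Period 2 along warp 0 contradicts the minimality of the order, which exceeds 4.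
  glide-impossible glide = proj₂ (proj₂ (order (warp 0ℤ))) 2 (s≤s z≤n)
    (ℕ.<-trans (s≤s (s≤s (s≤s z≤n))) 4<n) λ k →
      trans (cong₂ (λ i j → D (i , j)) (eq₁ p) (eq₂ q k))
        (trans (glide⇒column-period-2 t r glide (0ℤ - p) (k - q))
          (≡-sym (cong₂ (λ i j → D (i , j)) (eq₁ p) (eq₃ q k))))
    where
    eq₁ : ∀ p → 0ℤ ≡ p + (0ℤ - p)
    eq₁ = solve-∀
    eq₂ : ∀ q k → k + (1ℤ + 1ℤ) ≡ q + ((k - q) + (1ℤ + 1ℤ))
    eq₂ = solve-∀
    eq₃ : ∀ q k → k ≡ q + (k - q)
    eq₃ = solve-∀

  -- Precomposing with the half turn about the centre makes the first sign positive: equal signs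
  -- give a translation, unequal signs a glide.
  by-linear-part : ∀ n₁ n₂ → ¬ (∀ x y → E (sgn n₁ x + 1ℤ) (sgn n₂ y + t) ≡ E x y xor r)
  by-linear-part false false g = translation-impossible g
  by-linear-part false true  g = glide-impossible g
  by-linear-part true  true  g = translation-impossible λ x y →
    trans (cong₂ (λ i j → E (i + 1ℤ) (j + t)) (≡-sym (neg-involutive x)) (≡-sym (neg-involutive y)))
      (trans (g (- x) (- y)) (cong (_xor r) (half x y)))
  by-linear-part true  false g = glide-impossible λ x y →
    trans (cong (λ i → E (i + 1ℤ) (- y + t)) (≡-sym (neg-involutive x)))
      (trans (g (- x) (- y)) (cong (_xor r) (half x y)))
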